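{- Let $(I,\preccurlyeq)$ be a directed set, let $S(\Lambda^{\succcurlyeq})$ be a contravariant direct spectrum over $(I,\preccurlyeq)$ with sets $\lambda_0(i)$, transports $\lambda^{\succcurlyeq}_{ji}$ and Bishop spaces $\mathcal F_i=(\lambda_0(i),F_i)$, let $\mathcal F=(X,F)$ be a Bishop space, and let $\mathcal F\to S(\Lambda^{\succcurlyeq})$ be the contravariant direct spectrum over $(I,\preccurlyeq)$ with sets $\mathrm{Mor}(\mathcal F,\mathcal F_i)$, transports $(\lambda^{\succcurlyeq}_{ji})^-:\mathrm{Mor}(\mathcal F,\mathcal F_j)\to\mathrm{Mor}(\mathcal F,\mathcal F_i)$, $\theta\mapsto\lambda^{\succcurlyeq}_{ji}\circ\theta$ (for $i\preccurlyeq j$), and Bishop spaces $\mathcal F\to\mathcal F_i$. Then $\underset{\leftarrow}{\mathrm{Lim}}\,(\mathcal F\to\mathcal F_i)\simeq\mathcal F\to\underset{\leftarrow}{\mathrm{Lim}}\,\mathcal F_i$.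
   Context: Work in Bishop-style constructive mathematics. A directed set: a set with a reflexive transitive relation respecting equality, any two elements having a common upper bound. A contravariant direct family over $(I,\preccurlyeq)$: sets $\lambda_0(i)$ and functions $\lambda^{\succcurlyeq}_{ji}:\lambda_0(j)\to\lambda_0(i)$ for $i\preccurlyeq j$ with $\lambda^{\succcurlyeq}_{ii}=\mathrm{id}$ and $\lambda^{\succcurlyeq}_{ki}=\lambda^{\succcurlyeq}_{ji}\circ\lambda^{\succcurlyeq}_{kj}$ for $i\preccurlyeq j\preccurlyeq k$. Bishop spaces: a Bishop topology on $X$ is a set $F$ of functions $X\to\mathbb R$ containing constants, closed under addition, composition with functions $\mathbb R\to\mathbb R$ uniformly continuous on every $[-n,n]$, and uniform limits; $\bigvee F_0$ = least Bishop topology containing $F_0$; Bishop morphism $(X,F)\to(Y,G)$: a function $h$ with $g\circ h\in F$ for all $g\in G$; Bishop isomorphism: bijective morphism whose inverse is a morphism; $\simeq$: Bishop isomorphic. Exponential: $\mathcal F\to\mathcal G=(\mathrm{Mor}(\mathcal F,\mathcal G),\bigvee\{\phi_{x,g}:x\in X,g\in G\})$, $\phi_{x,g}(h)=g(h(x))$. A contravariant direct spectrum: a contravariant direct family with Bishop topologies on each set making all transports Bishop morphisms. Inverse limit of a contravariant spectrum (sets $\nu_0(i)$, transports $\nu^{\succcurlyeq}_{ji}$, topologies $H_i$): $\prod^{\succcurlyeq}\nu_0(i)$ = dependent assignments $\Phi$ with $\Phi_i\in\nu_0(i)$ and $\Phi_i=\nu^{\succcurlyeq}_{ji}(\Phi_j)$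 for $i\preccurlyeq j$ (pointwise equality); $\pi_i(\Phi)=\Phi_i$; $\underset{\leftarrow}{\mathrm{Lim}}\,\mathcal H_i=(\prod^{\succcurlyeq}\nu_0(i),\bigvee\{h\circ\pi_i:i\in I,h\in H_i\})$. -}

module Defs where

open import Data.Integer as ℤ using (+_; +[1+_]; -[1+_])
open import Data.Nat as ℕ using (ℕ; suc)
import Data.Nat.Properties as ℕ
import Data.Integer.Properties as ℤ
open import Data.Product using (Σ-syntax; ∃-syntax; _×_; _,_; proj₁; proj₂)
open import Data.Rational as ℚ using (ℚ; mkℚ; 0ℚ)
import Data.Rational.Properties as ℚ
open import Data.Rational.Solver using (module +-*-Solver)
import Data.Rational.Unnormalised as ℚᵘ
import Data.Rational.Unnormalised.Properties as ℚᵘ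
open import Data.Sum using (inj₁; inj₂)
open import Function.Bundles using (Func; _⟨$⟩_)
open import Function.Definitions using (Inverseᵇ)
import Function.Construct.Composition as Composition
import Function.Relation.Binary.Setoid.Equality as FunctionEquality
open import Level using (Level; _⊔_; 0ℓ) renaming (suc to lsuc)
open import Relation.Binary.Bundles using (Setoid; Preorder)
import Relation.Binary.Construct.On as On
open import Relation.Binary.PropositionalEquality
  using (_≡_; refl; sym; trans; cong; cong₂; subst; subst₂)
open import Relation.Unary using (Pred; _∈_)

private variable
  a ℓ r c e p c′ e′ p′ c″ e″ q : Level

------------------------------------------------------------------------
-- Bishop's real numbers: regular sequences of rationals.  Bishop indexes
-- sequences by n ≥ 1; here the entry at n : ℕ is his entry at n + 1, so
-- that δ n plays the role of his 1/(n + 1).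

δ : ℕ → ℚ
δ n = + 1 ℚ./ suc n

-- No eta, and operations defined by copatterns, so that conversion checking
-- compares x +ʳ y with x′ +ʳ y′ argumentwise instead of unfolding proofs.
record ℝ : Set where
  no-eta-equality
  field
    seq     : ℕ → ℚ
    regular : ∀ m n → ℚ.∣ seq m ℚ.- seq n ∣ ℚ.≤ δ m ℚ.+ δ n

open ℝ public

infix 4 _≈ʳ_

-- Wrapped in a record so that x and y can be inferred from x ≈ʳ y.
record _≈ʳ_ (x y : ℝ) : Set where
  constructor close
  field
    close⁻¹ : ∀ n → ℚ.∣ seq x n ℚ.- seq y n ∣ ℚ.≤ δ n ℚ.+ δ n

open _≈ʳ_ public

-- double n is Bishop's index 2(n + 1) in the shifted numbering.
double : ℕ → ℕ
double n = n ℕ.+ suc n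

private
  open +-*-Solver

  δ≡ : ∀ n → ℚ.toℚᵘ (δ n) ℚᵘ.≃ ℚᵘ.mkℚᵘ (+ 1) n
  δ≡ n = ℚ.toℚᵘ-fromℚᵘ (ℚᵘ.mkℚᵘ (+ 1) n)

  δ-double : ∀ n → δ (double n) ℚ.+ δ (double n) ≡ δ n
  δ-double n = ℚ.toℚᵘ-injective (begin
    ℚ.toℚᵘ (δ d ℚ.+ δ d)                    ≈⟨ ℚ.toℚᵘ-homo-+ (δ d) (δ d) ⟩
    ℚ.toℚᵘ (δ d) ℚᵘ.+ ℚ.toℚᵘ (δ d)          ≈⟨ ℚᵘ.+-cong (δ≡ d) (δ≡ d) ⟩
    ℚᵘ.mkℚᵘ (+ 1) d ℚᵘ.+ ℚᵘ.mkℚᵘ (+ 1) d    ≈⟨ ℚᵘ.*≡* (cong +_ core) ⟩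
    ℚᵘ.mkℚᵘ (+ 1) n                         ≈⟨ ℚᵘ.≃-sym (δ≡ n) ⟩
    ℚ.toℚᵘ (δ n)                            ∎)
    where
    open import Relation.Binary.Reasoning.Setoid ℚᵘ.≃-setoid
    open import Data.Nat.Solver renaming (module +-*-Solver to ℕ-Solver)
    d = double n
    core : (1 ℕ.* suc d ℕ.+ 1 ℕ.* suc d) ℕ.* suc n ≡ 1 ℕ.* (suc d ℕ.* suc d)
    core = ℕ-Solver.solve 1 (λ n →
      let s = ℕ-Solver.con 1 ℕ-Solver.:+ n
          d = ℕ-Solver.con 1 ℕ-Solver.:+ (n ℕ-Solver.:+ s)
          one = ℕ-Solver.con 1
      in (one ℕ-Solver.:* d ℕ-Solver.:+ one ℕ-Solver.:* d) ℕ-Solver.:* s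
           ℕ-Solver.:= one ℕ-Solver.:* (d ℕ-Solver.:* d)) refl n

  ∣-∣-sym : ∀ x y → ℚ.∣ x ℚ.- y ∣ ≡ ℚ.∣ y ℚ.- x ∣
  ∣-∣-sym x y = trans
    (cong ℚ.∣_∣ (solve 2 (λ x y → x :- y := :- (y :- x)) refl x y))
    (ℚ.∣-p∣≡∣p∣ (y ℚ.- x))

  ∣-∣-triangle : ∀ x y z → ℚ.∣ x ℚ.- z ∣ ℚ.≤ ℚ.∣ x ℚ.- y ∣ ℚ.+ ℚ.∣ y ℚ.- z ∣
  ∣-∣-triangle x y z = subst (λ w → ℚ.∣ w ∣ ℚ.≤ ℚ.∣ x ℚ.- y ∣ ℚ.+ ℚ.∣ y ℚ.- z ∣)
    (solve 3 (λ x y z → (x :- y) :+ (y :- z) := x :- z) refl x y z)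
    (ℚ.∣p+q∣≤∣p∣+∣q∣ (x ℚ.- y) (y ℚ.- z))

  ∣-∣-+ : ∀ x y x′ y′ →
          ℚ.∣ (x ℚ.+ y) ℚ.- (x′ ℚ.+ y′) ∣ ℚ.≤ ℚ.∣ x ℚ.- x′ ∣ ℚ.+ ℚ.∣ y ℚ.- y′ ∣
  ∣-∣-+ x y x′ y′ = subst (λ w → ℚ.∣ w ∣ ℚ.≤ ℚ.∣ x ℚ.- x′ ∣ ℚ.+ ℚ.∣ y ℚ.- y′ ∣)
    (solve 4 (λ x y x′ y′ → (x :- x′) :+ (y :- y′) := (x :+ y) :- (x′ :+ y′))
      refl x y x′ y′)
    (ℚ.∣p+q∣≤∣p∣+∣q∣ (x ℚ.- x′) (y ℚ.- y′))

  ∣-∣-neg : ∀ x y → ℚ.∣ ℚ.- x ℚ.- (ℚ.- y) ∣ ≡ ℚ.∣ x ℚ.- y ∣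
  ∣-∣-neg x y = trans
    (cong ℚ.∣_∣ (solve 2 (λ x y → (:- x) :- (:- y) := :- (x :- y)) refl x y))
    (ℚ.∣-p∣≡∣p∣ (x ℚ.- y))

  ∣x∣-∣y∣≤∣x-y∣ : ∀ x y → ℚ.∣ x ∣ ℚ.- ℚ.∣ y ∣ ℚ.≤ ℚ.∣ x ℚ.- y ∣
  ∣x∣-∣y∣≤∣x-y∣ x y = subst (ℚ.∣ x ∣ ℚ.- ℚ.∣ y ∣ ℚ.≤_)
    (solve 2 (λ u v → (u :+ v) :- v := u) refl ℚ.∣ x ℚ.- y ∣ ℚ.∣ y ∣)
    (ℚ.+-monoˡ-≤ (ℚ.- ℚ.∣ y ∣)
      (subst (λ w → ℚ.∣ w ∣ ℚ.≤ ℚ.∣ x ℚ.- y ∣ ℚ.+ ℚ.∣ y ∣)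
        (solve 2 (λ x y → (x :- y) :+ y := x) refl x y)
        (ℚ.∣p+q∣≤∣p∣+∣q∣ (x ℚ.- y) y)))

  ∣-∣-abs : ∀ x y → ℚ.∣ ℚ.∣ x ∣ ℚ.- ℚ.∣ y ∣ ∣ ℚ.≤ ℚ.∣ x ℚ.- y ∣
  ∣-∣-abs x y with ℚ.∣p∣≡p∨∣p∣≡-p (ℚ.∣ x ∣ ℚ.- ℚ.∣ y ∣)
  ... | inj₁ eq = subst (ℚ._≤ ℚ.∣ x ℚ.- y ∣) (sym eq) (∣x∣-∣y∣≤∣x-y∣ x y)
  ... | inj₂ eq = subst₂ ℚ._≤_
    (sym (trans eq (solve 2 (λ u v → :- (u :- v) := v :- u) refl ℚ.∣ x ∣ ℚ.∣ y ∣)))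
    (∣-∣-sym y x)
    (∣x∣-∣y∣≤∣x-y∣ y x)

  0≤δ : ∀ n → 0ℚ ℚ.≤ δ n
  0≤δ n = ℚ.nonNegative⁻¹ (δ n) {{ℚ.normalize-nonNeg 1 (suc n)}}

  ∣x-x∣≤ : ∀ x m n → ℚ.∣ x ℚ.- x ∣ ℚ.≤ δ m ℚ.+ δ n
  ∣x-x∣≤ x m n = subst (ℚ._≤ δ m ℚ.+ δ n)
    (cong ℚ.∣_∣ (sym (ℚ.+-inverseʳ x)))
    (ℚ.+-mono-≤ (0≤δ m) (0≤δ n))

  δ-small : ∀ x → 0ℚ ℚ.< x → ∃[ m ] δ m ℚ.< x
  δ-small x@(mkℚ +[1+ n ] d _) _ = suc d , ℚ.toℚᵘ-cancel-<
    (ℚᵘ.<-respˡ-≃ (ℚᵘ.≃-sym (δ≡ (suc d)))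
      (ℚᵘ.*<* (ℤ.+<+ (ℕ.<-≤-trans
        (ℕ.≤-reflexive (cong suc (ℕ.+-identityʳ (suc d))))
        (ℕ.m≤n*m (suc (suc d)) (suc n))))))
  δ-small (mkℚ (+ 0)    d _) (ℚ.*<* (ℤ.+<+ ()))
  δ-small (mkℚ -[1+ n ] d _) (ℚ.*<* ())

  archimedean : ∀ x y → (∀ m → x ℚ.≤ y ℚ.+ δ m) → x ℚ.≤ y
  archimedean x y x≤y+δ = ℚ.≮⇒≥ λ y<x →
    let 0<x-y = subst (ℚ._< x ℚ.- y) (ℚ.+-inverseʳ y) (ℚ.+-monoˡ-< (ℚ.- y) y<x)
        m , δm<x-y = δ-small (x ℚ.- y) 0<x-y
        y+δ<x = subst (y ℚ.+ δ m ℚ.<_)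
                  (solve 2 (λ x y → y :+ (x :- y) := x) refl x y)
                  (ℚ.+-monoʳ-< y δm<x-y)
    in ℚ.<-irrefl refl (ℚ.≤-<-trans (x≤y+δ m) y+δ<x)

  ≈ʳ-trans : ∀ {x y z} → x ≈ʳ y → y ≈ʳ z → x ≈ʳ z
  ≈ʳ-trans {x} {y} {z} (close x≈y) (close y≈z) = close λ n →
    archimedean ℚ.∣ seq x n ℚ.- seq z n ∣ (δ n ℚ.+ δ n) (bound n)
    where
    bound : ∀ n m → ℚ.∣ seq x n ℚ.- seq z n ∣ ℚ.≤ (δ n ℚ.+ δ n) ℚ.+ δ m
    bound n m = begin
      ℚ.∣ seq x n ℚ.- seq z n ∣
        ≤⟨ ∣-∣-triangle (seq x n) (seq x k) (seq z n) ⟩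
      ℚ.∣ seq x n ℚ.- seq x k ∣ ℚ.+ ℚ.∣ seq x k ℚ.- seq z n ∣
        ≤⟨ ℚ.+-mono-≤ (regular x n k) (∣-∣-triangle (seq x k) (seq y k) (seq z n)) ⟩
      (δ n ℚ.+ δ k) ℚ.+ (ℚ.∣ seq x k ℚ.- seq y k ∣ ℚ.+ ℚ.∣ seq y k ℚ.- seq z n ∣)
        ≤⟨ ℚ.+-monoʳ-≤ (δ n ℚ.+ δ k) (ℚ.+-mono-≤ (x≈y k)
             (∣-∣-triangle (seq y k) (seq z k) (seq z n))) ⟩
      (δ n ℚ.+ δ k) ℚ.+ ((δ k ℚ.+ δ k) ℚ.+
        (ℚ.∣ seq y k ℚ.- seq z k ∣ ℚ.+ ℚ.∣ seq z k ℚ.- seq z n ∣))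
        ≤⟨ ℚ.+-monoʳ-≤ (δ n ℚ.+ δ k) (ℚ.+-monoʳ-≤ (δ k ℚ.+ δ k)
             (ℚ.+-mono-≤ (y≈z k) (regular z k n))) ⟩
      six
        ≡⟨ ℚ.+-identityʳ six ⟨
      six ℚ.+ 0ℚ
        ≤⟨ ℚ.+-monoʳ-≤ six (ℚ.+-mono-≤ (0≤δ k) (0≤δ k)) ⟩
      six ℚ.+ (δ k ℚ.+ δ k)
        ≡⟨ solve 2 (λ n k →
             (n :+ k) :+ ((k :+ k) :+ ((k :+ k) :+ (k :+ n))) :+ (k :+ k)
             := (n :+ n) :+ (((k :+ k) :+ (k :+ k)) :+ ((k :+ k) :+ (k :+ k))))
             refl (δ n) (δ k) ⟩
      (δ n ℚ.+ δ n) ℚ.+ (((δ k ℚ.+ δ k) ℚ.+ (δ k ℚ.+ δ k)) ℚ.+ ((δ k ℚ.+ δ k) ℚ.+ (δ k ℚ.+ δ k)))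
        ≡⟨ cong ((δ n ℚ.+ δ n) ℚ.+_) 8δk≡δm ⟩
      (δ n ℚ.+ δ n) ℚ.+ δ m ∎
      where
      open ℚ.≤-Reasoning
      k = double (double (double m))
      six = (δ n ℚ.+ δ k) ℚ.+ ((δ k ℚ.+ δ k) ℚ.+ ((δ k ℚ.+ δ k) ℚ.+ (δ k ℚ.+ δ n)))
      twice : ∀ {x y} → x ≡ y → x ℚ.+ x ≡ y ℚ.+ y
      twice eq = cong₂ ℚ._+_ eq eq
      8δk≡δm : ((δ k ℚ.+ δ k) ℚ.+ (δ k ℚ.+ δ k)) ℚ.+ ((δ k ℚ.+ δ k) ℚ.+ (δ k ℚ.+ δ k)) ≡ δ m
      8δk≡δm = trans (twice (trans (twice (δ-double (double (double m))))
                                   (δ-double (double m))))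
                     (δ-double m)

ℝ-setoid : Setoid 0ℓ 0ℓ
ℝ-setoid = record
  { Carrier       = ℝ
  ; _≈_           = _≈ʳ_
  ; isEquivalence = record
    { refl  = λ {x} → close λ n → ∣x-x∣≤ (seq x n) n n
    ; sym   = λ {x} {y} (close x≈y) → close λ n →
        subst (ℚ._≤ δ n ℚ.+ δ n) (∣-∣-sym (seq x n) (seq y n)) (x≈y n)
    ; trans = ≈ʳ-trans
    }
  }

fromℚ : ℚ → ℝ
seq     (fromℚ x) _ = x
regular (fromℚ x)   = ∣x-x∣≤ x

fromℕ : ℕ → ℝ
fromℕ n = fromℚ (+ n ℚ./ 1)

infixl 6 _+ʳ_ _-ʳ_
infix  8 -ʳ_

_+ʳ_ : ℝ → ℝ → ℝ
seq     (x +ʳ y) n   = seq x (double n) ℚ.+ seq y (double n)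
regular (x +ʳ y) m n = begin
  ℚ.∣ (seq x (double m) ℚ.+ seq y (double m)) ℚ.- (seq x (double n) ℚ.+ seq y (double n)) ∣
    ≤⟨ ∣-∣-+ (seq x (double m)) (seq y (double m)) (seq x (double n)) (seq y (double n)) ⟩
  ℚ.∣ seq x (double m) ℚ.- seq x (double n) ∣ ℚ.+ ℚ.∣ seq y (double m) ℚ.- seq y (double n) ∣
    ≤⟨ ℚ.+-mono-≤ (regular x (double m) (double n)) (regular y (double m) (double n)) ⟩
  (δ (double m) ℚ.+ δ (double n)) ℚ.+ (δ (double m) ℚ.+ δ (double n))
    ≡⟨ solve 2 (λ m n → (m :+ n) :+ (m :+ n) := (m :+ m) :+ (n :+ n)) refl
         (δ (double m)) (δ (double n)) ⟩
  (δ (double m) ℚ.+ δ (double m)) ℚ.+ (δ (double n) ℚ.+ δ (double n))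
    ≡⟨ cong₂ ℚ._+_ (δ-double m) (δ-double n) ⟩
  δ m ℚ.+ δ n ∎
  where open ℚ.≤-Reasoning

-ʳ_ : ℝ → ℝ
seq     (-ʳ x) n   = ℚ.- seq x n
regular (-ʳ x) m n = subst (ℚ._≤ δ m ℚ.+ δ n)
                       (sym (∣-∣-neg (seq x m) (seq x n))) (regular x m n)

_-ʳ_ : ℝ → ℝ → ℝ
x -ʳ y = x +ʳ (-ʳ y)

∣_∣ʳ : ℝ → ℝ
seq     ∣ x ∣ʳ n   = ℚ.∣ seq x n ∣
regular ∣ x ∣ʳ m n = ℚ.≤-trans (∣-∣-abs (seq x m) (seq x n)) (regular x m n)

+ʳ-cong : ∀ {x x′ y y′} → x ≈ʳ x′ → y ≈ʳ y′ → x +ʳ y ≈ʳ x′ +ʳ y′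
+ʳ-cong {x} {x′} {y} {y′} (close x≈x′) (close y≈y′) = close λ n →
  let d = double n in ℚ.≤-trans
    (∣-∣-+ (seq x d) (seq y d) (seq x′ d) (seq y′ d))
    (subst₂ (λ u v → ℚ.∣ seq x d ℚ.- seq x′ d ∣ ℚ.+ ℚ.∣ seq y d ℚ.- seq y′ d ∣ ℚ.≤ u ℚ.+ v)
      (δ-double n) (δ-double n)
      (ℚ.+-mono-≤ (x≈x′ d) (y≈y′ d)))

Positive : ℝ → Set
Positive x = ∃[ n ] δ n ℚ.< seq x n

NonNegative : ℝ → Set
NonNegative x = ∀ n → ℚ.- δ n ℚ.≤ seq x n

infix 4 _≤ʳ_

_≤ʳ_ : ℝ → ℝ → Set
x ≤ʳ y = NonNegative (y -ʳ x)

------------------------------------------------------------------------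
-- Real-valued functions.  Sets are setoids and functions are Func, i.e.
-- they respect equality.

infixr 9 _∘ᶠ_

_∘ᶠ_ : {X : Setoid c e} {Y : Setoid c′ e′} {Z : Setoid c″ e″} →
       Func Y Z → Func X Y → Func X Z
g ∘ᶠ f = Composition.function f g

ℝ-Func : Setoid c e → Set (c ⊔ e)
ℝ-Func X = Func X ℝ-setoid

module _ {X : Setoid c e} where

  infix 4 _≈ᶠ_

  _≈ᶠ_ : ℝ-Func X → ℝ-Func X → Set c
  _≈ᶠ_ = FunctionEquality._≈_ X ℝ-setoid

  constᶠ : ℝ → ℝ-Func X
  constᶠ x = record { to = λ _ → x ; cong = λ _ → Setoid.refl ℝ-setoid }

  infixl 6 _+ᶠ_

  _+ᶠ_ : ℝ-Func X → ℝ-Func X → ℝ-Func X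
  f +ᶠ g = record
    { to   = λ x → (f ⟨$⟩ x) +ʳ (g ⟨$⟩ x)
    ; cong = λ x≈y → +ʳ-cong (Func.cong f x≈y) (Func.cong g x≈y)
    }

  UniformlyWithin : ℝ → ℝ-Func X → ℝ-Func X → Set c
  UniformlyWithin ε g f = ∀ x → ∣ (g ⟨$⟩ x) -ʳ (f ⟨$⟩ x) ∣ʳ ≤ʳ ε

infix 4 _∈[±_]

_∈[±_] : ℝ → ℕ → Set
x ∈[± n ] = (-ʳ fromℕ n ≤ʳ x) × (x ≤ʳ fromℕ n)

UniformlyContinuousOnIntervals : ℝ-Func ℝ-setoid → Set
UniformlyContinuousOnIntervals φ =
  ∀ n ε → Positive ε → Σ[ ω ∈ ℝ ] Positive ω ×
    (∀ x y → x ∈[± n ] → y ∈[± n ] →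
      ∣ x -ʳ y ∣ʳ ≤ʳ ω → ∣ (φ ⟨$⟩ x) -ʳ (φ ⟨$⟩ y) ∣ʳ ≤ʳ ε)

------------------------------------------------------------------------
-- Bishop spaces

record IsBishopTopology {X : Setoid c e} (F : Pred (ℝ-Func X) p) : Set (c ⊔ e ⊔ p) where
  field
    -- F is a subset of the set of functions, hence closed under equality.
    resp        : ∀ f g → f ≈ᶠ g → f ∈ F → g ∈ F
    const       : ∀ x → constᶠ x ∈ F
    add         : ∀ {f g} → f ∈ F → g ∈ F → f +ᶠ g ∈ F
    comp        : ∀ {f} φ → UniformlyContinuousOnIntervals φ → f ∈ F → φ ∘ᶠ f ∈ F
    uniform-lim : ∀ f → (∀ ε → Positive ε → ∃[ g ] g ∈ F × UniformlyWithin ε g f) → f ∈ F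

record BishopTopology (X : Setoid c e) (p : Level) : Set (c ⊔ e ⊔ lsuc p) where
  field
    Member           : Pred (ℝ-Func X) p
    isBishopTopology : IsBishopTopology Member

  open IsBishopTopology isBishopTopology public

record BishopSpace (c e p : Level) : Set (lsuc (c ⊔ e ⊔ p)) where
  field
    set      : Setoid c e
    topology : BishopTopology set p

  open Setoid set public using (Carrier)
  open BishopTopology topology public

data Generated {X : Setoid c e} (F₀ : Pred (ℝ-Func X) q) : Pred (ℝ-Func X) (c ⊔ e ⊔ q) where
  base        : ∀ {f} → f ∈ F₀ → f ∈ Generated F₀
  resp        : ∀ f g → f ≈ᶠ g → f ∈ Generated F₀ → g ∈ Generated F₀
  const       : ∀ x → constᶠ x ∈ Generated F₀
  add         : ∀ {f g} → f ∈ Generated F₀ → g ∈ Generated F₀ → f +ᶠ g ∈ Generated F₀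
  comp        : ∀ {f} φ → UniformlyContinuousOnIntervals φ →
                f ∈ Generated F₀ → φ ∘ᶠ f ∈ Generated F₀
  uniform-lim : ∀ f → (∀ ε → Positive ε → ∃[ g ] g ∈ Generated F₀ × UniformlyWithin ε g f) →
                f ∈ Generated F₀

⋁ : {X : Setoid c e} → Pred (ℝ-Func X) q → BishopTopology X (c ⊔ e ⊔ q)
⋁ F₀ = record
  { Member           = Generated F₀
  ; isBishopTopology = record
    { resp = resp ; const = const ; add = add ; comp = comp ; uniform-lim = uniform-lim }
  }

⋁-least : {X : Setoid c e} {F₀ : Pred (ℝ-Func X) q} {F : Pred (ℝ-Func X) p} →
          IsBishopTopology F → (∀ f → f ∈ F₀ → f ∈ F) →
          ∀ f → f ∈ Generated F₀ → f ∈ F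
⋁-least {F₀ = F₀} {F = F} isTop F₀⊆F = go
  where
  module F = IsBishopTopology isTop
  go : ∀ f → f ∈ Generated F₀ → f ∈ F
  go f  (base f∈F₀)          = F₀⊆F f f∈F₀
  go ._ (resp f g f≈g f∈)    = F.resp f g f≈g (go f f∈)
  go ._ (const x)            = F.const x
  go ._ (add {f} {g} f∈ g∈)  = F.add (go f f∈) (go g g∈)
  go ._ (comp {f} φ uc f∈)   = F.comp φ uc (go f f∈)
  go ._ (uniform-lim f lim)  = F.uniform-lim f λ ε ε>0 →
    proj₁ (lim ε ε>0) , go _ (proj₁ (proj₂ (lim ε ε>0))) , proj₂ (proj₂ (lim ε ε>0))

-- A function into a generated topology is a morphism as soon as it pulls
-- the generators back into the topology of its domain.
⋁-lift : {X : Setoid c e} {Y : Setoid c′ e′} (T : BishopTopology X p) {F₀ : Pred (ℝ-Func Y) q}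
         (h : Func X Y) → (∀ f → f ∈ F₀ → f ∘ᶠ h ∈ BishopTopology.Member T) →
         ∀ f → f ∈ Generated F₀ → f ∘ᶠ h ∈ BishopTopology.Member T
⋁-lift {Y = Y} T h F₀⊆ = ⋁-least pullback F₀⊆
  where
  module T = BishopTopology T
  open Setoid ℝ-setoid using () renaming (refl to ≈ʳ-refl)

  pullback : IsBishopTopology {X = Y} (λ f → f ∘ᶠ h ∈ T.Member)
  pullback = record
    { resp        = λ f g f≈g → T.resp (f ∘ᶠ h) (g ∘ᶠ h) (λ x → f≈g (h ⟨$⟩ x))
    ; const       = λ x → T.resp (constᶠ x) (constᶠ x ∘ᶠ h) (λ _ → ≈ʳ-refl) (T.const x)
    ; add         = λ {f} {g} f∈ g∈ →
        T.resp (f ∘ᶠ h +ᶠ g ∘ᶠ h) ((f +ᶠ g) ∘ᶠ h) (λ _ → ≈ʳ-refl) (T.add f∈ g∈)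
    ; comp        = λ {f} φ uc f∈ →
        T.resp (φ ∘ᶠ (f ∘ᶠ h)) ((φ ∘ᶠ f) ∘ᶠ h) (λ _ → ≈ʳ-refl) (T.comp φ uc f∈)
    ; uniform-lim = λ f lim → T.uniform-lim (f ∘ᶠ h) λ ε ε>0 →
        let g , g∈ , g~f = lim ε ε>0
        in g ∘ᶠ h , g∈ , λ x → g~f (h ⟨$⟩ x)
    }

module _ (𝓕 : BishopSpace c e p) (𝓖 : BishopSpace c′ e′ p′) where
  private
    module F = BishopSpace 𝓕
    module G = BishopSpace 𝓖

  IsMorphism : Func F.set G.set → Set (p ⊔ c′ ⊔ e′ ⊔ p′)
  IsMorphism h = ∀ g → g ∈ G.Member → g ∘ᶠ h ∈ F.Member

  record Morphism : Set (c ⊔ e ⊔ p ⊔ c′ ⊔ e′ ⊔ p′) where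
    field
      fun        : Func F.set G.set
      isMorphism : IsMorphism fun

  Mor : Setoid (c ⊔ e ⊔ p ⊔ c′ ⊔ e′ ⊔ p′) (c ⊔ e′)
  Mor = On.setoid (FunctionEquality.setoid F.set G.set) Morphism.fun

infix 4 _≃_

record _≃_ (𝓕 : BishopSpace c e p) (𝓖 : BishopSpace c′ e′ p′) :
           Set (c ⊔ e ⊔ p ⊔ c′ ⊔ e′ ⊔ p′) where
  field
    to      : Morphism 𝓕 𝓖
    from    : Morphism 𝓖 𝓕
    inverse : Inverseᵇ (Setoid._≈_ (BishopSpace.set 𝓕)) (Setoid._≈_ (BishopSpace.set 𝓖))
                (Morphism.fun to ⟨$⟩_) (Morphism.fun from ⟨$⟩_)

module _ (𝓕 : BishopSpace c e p) (𝓖 : BishopSpace c′ e′ p′) where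
  private
    module F = BishopSpace 𝓕
    module G = BishopSpace 𝓖

  evalᶠ : F.Carrier → ℝ-Func G.set → ℝ-Func (Mor 𝓕 𝓖)
  evalᶠ x g = record
    { to   = λ h → g ⟨$⟩ (Morphism.fun h ⟨$⟩ x)
    ; cong = λ h≈h′ → Func.cong g (h≈h′ x)
    }

  Evaluations : Pred (ℝ-Func (Mor 𝓕 𝓖)) (c ⊔ e ⊔ p ⊔ c′ ⊔ e′ ⊔ p′)
  Evaluations k = Σ[ x ∈ F.Carrier ] Σ[ g ∈ ℝ-Func G.set ] g ∈ G.Member × k ≈ᶠ evalᶠ x g

  infixr 6 _⇒_

  _⇒_ : BishopSpace (c ⊔ e ⊔ p ⊔ c′ ⊔ e′ ⊔ p′) (c ⊔ e′) (c ⊔ e ⊔ p ⊔ c′ ⊔ e′ ⊔ p′)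
  _⇒_ = record { set = Mor 𝓕 𝓖 ; topology = ⋁ Evaluations }

------------------------------------------------------------------------
-- Directed sets, contravariant spectra and their limits

-- The preorder of the library is reflexive with respect to its underlying
-- equality, which together with transitivity makes it respect equality.
record DirectedSet (a ℓ r : Level) : Set (lsuc (a ⊔ ℓ ⊔ r)) where
  field
    preorder : Preorder a ℓ r

  open Preorder preorder public
    using (Carrier; _≈_; isPreorder) renaming (_≲_ to _≼_; refl to ≼-refl; trans to ≼-trans)

  field
    upperBound : ∀ i j → ∃[ k ] i ≼ k × j ≼ k

-- Indices that are merely equal are also comparable, so the transports
-- include those along the equality of I.  The laws are stated for
-- arbitrary proofs of i ≼ j; hence (take j = k in transport-∘) a transport
-- depends only on its endpoints.
record ContravariantFamily (I : DirectedSet a ℓ r) (c e : Level) :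
                           Set (a ⊔ r ⊔ lsuc (c ⊔ e)) where
  open DirectedSet I using (_≼_) renaming (Carrier to Index)
  field
    λ₀           : Index → Setoid c e
    transport    : ∀ {i j} → i ≼ j → Func (λ₀ j) (λ₀ i)
    transport-id : ∀ {i} (i≼i : i ≼ i) x → Setoid._≈_ (λ₀ i) (transport i≼i ⟨$⟩ x) x
    transport-∘  : ∀ {i j k} (i≼j : i ≼ j) (j≼k : j ≼ k) (i≼k : i ≼ k) x →
                   Setoid._≈_ (λ₀ i) (transport i≼k ⟨$⟩ x)
                                     (transport i≼j ⟨$⟩ (transport j≼k ⟨$⟩ x))

record ContravariantSpectrum (I : DirectedSet a ℓ r) (c e p : Level) :
                             Set (a ⊔ r ⊔ lsuc (c ⊔ e ⊔ p)) where
  open DirectedSet I using (_≼_) renaming (Carrier to Index)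
  field
    family   : ContravariantFamily I c e
  open ContravariantFamily family public
  field
    topology : ∀ i → BishopTopology (λ₀ i) p

  space : Index → BishopSpace c e p
  space i = record { set = λ₀ i ; topology = topology i }

  field
    transport-morphism : ∀ {i j} (i≼j : i ≼ j) →
                         IsMorphism (space j) (space i) (transport i≼j)

module _ {I : DirectedSet a ℓ r} (S : ContravariantSpectrum I c e p) where
  open DirectedSet I using (_≼_) renaming (Carrier to Index)
  open ContravariantSpectrum S
  private module S i = BishopSpace (space i)

  record Thread : Set (a ⊔ r ⊔ c ⊔ e) where
    field
      at         : ∀ i → S.Carrier i
      compatible : ∀ {i j} (i≼j : i ≼ j) →
                   Setoid._≈_ (λ₀ i) (at i) (transport i≼j ⟨$⟩ at j)

  ThreadSetoid : Setoid (a ⊔ r ⊔ c ⊔ e) (a ⊔ e)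
  ThreadSetoid = record
    { Carrier       = Thread
    ; _≈_           = λ Φ Ψ → ∀ i → Setoid._≈_ (λ₀ i) (Thread.at Φ i) (Thread.at Ψ i)
    ; isEquivalence = record
      { refl  = λ i → Setoid.refl (λ₀ i)
      ; sym   = λ Φ≈Ψ i → Setoid.sym (λ₀ i) (Φ≈Ψ i)
      ; trans = λ Φ≈Ψ Ψ≈Ω i → Setoid.trans (λ₀ i) (Φ≈Ψ i) (Ψ≈Ω i)
      }
    }

  π : ∀ i → Func ThreadSetoid (λ₀ i)
  π i = record { to = λ Φ → Thread.at Φ i ; cong = λ Φ≈Ψ → Φ≈Ψ i }

  Projections : Pred (ℝ-Func ThreadSetoid) (a ⊔ r ⊔ c ⊔ e ⊔ p)
  Projections k = Σ[ i ∈ Index ] Σ[ h ∈ ℝ-Func (λ₀ i) ] h ∈ S.Member i × k ≈ᶠ h ∘ᶠ π i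

  InverseLimit : BishopSpace (a ⊔ r ⊔ c ⊔ e) (a ⊔ e) (a ⊔ r ⊔ c ⊔ e ⊔ p)
  InverseLimit = record { set = ThreadSetoid ; topology = ⋁ Projections }

infixr 6 _⇒ˢ_

_⇒ˢ_ : {I : DirectedSet a ℓ r} → BishopSpace c′ e′ p′ → ContravariantSpectrum I c e p →
       ContravariantSpectrum I (c′ ⊔ e′ ⊔ p′ ⊔ c ⊔ e ⊔ p) (c′ ⊔ e) (c′ ⊔ e′ ⊔ p′ ⊔ c ⊔ e ⊔ p)
_⇒ˢ_ {I = I} 𝓕 S = record
  { family = record
    { λ₀           = λ i → Mor 𝓕 (space i)
    ; transport    = postcompose
    ; transport-id = λ i≼i θ x → transport-id i≼i (Morphism.fun θ ⟨$⟩ x)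
    ; transport-∘  = λ i≼j j≼k i≼k θ x → transport-∘ i≼j j≼k i≼k (Morphism.fun θ ⟨$⟩ x)
    }
  ; topology           = λ i → BishopSpace.topology (𝓕 ⇒ space i)
  ; transport-morphism = λ {i} {j} i≼j →
      ⋁-lift (BishopSpace.topology (𝓕 ⇒ space j)) (postcompose i≼j) (evaluation i≼j)
  }
  where
  open DirectedSet I using (_≼_)
  open ContravariantSpectrum S

  postcompose : ∀ {i j} → i ≼ j → Func (Mor 𝓕 (space j)) (Mor 𝓕 (space i))
  postcompose i≼j = record
    { to   = λ θ → record
      { fun        = transport i≼j ∘ᶠ Morphism.fun θ
      ; isMorphism = λ g g∈ →
          Morphism.isMorphism θ (g ∘ᶠ transport i≼j) (transport-morphism i≼j g g∈)
      }
    ; cong = λ θ≈θ′ x → Func.cong (transport i≼j) (θ≈θ′ x)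
    }

  evaluation : ∀ {i j} (i≼j : i ≼ j) f → f ∈ Evaluations 𝓕 (space i) →
               f ∘ᶠ postcompose i≼j ∈ BishopSpace.Member (𝓕 ⇒ space j)
  evaluation i≼j f (x , g , g∈ , f≈) =
    base (x , g ∘ᶠ transport i≼j , transport-morphism i≼j g g∈ ,
          λ θ → f≈ (postcompose i≼j ⟨$⟩ θ))

{-# OPTIONS --safe #-}
-- A thread of morphisms 𝓕 → 𝓕ᵢ and a morphism from 𝓕 into the limit are the
-- same two-variable function (x , i) ↦ Φᵢ x.  Both topologies are generated by
-- the functions Φ ↦ g (Φᵢ x) with g ∈ Fᵢ, but each through an intermediate
-- generated topology (on Lim 𝓕ᵢ, respectively on 𝓕 → 𝓕ᵢ), so ⋁-lift is applied
-- once more with x, respectively i, held fixed.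
module Submission where

open import Data.Product using (_,_)
open import Function.Bundles using (Func; _⟨$⟩_)
open import Level using (Level)
open import Relation.Binary.Bundles using (Setoid)
open import Defs

private variable
  a ℓ r c e p c′ e′ p′ c″ e″ p″ : Level

evaluateAt : (𝓕 : BishopSpace c e p) (𝓖 : BishopSpace c′ e′ p′) →
             BishopSpace.Carrier 𝓕 → Func (Mor 𝓕 𝓖) (BishopSpace.set 𝓖)
evaluateAt 𝓕 𝓖 x = record
  { to   = λ θ → Morphism.fun θ ⟨$⟩ x
  ; cong = λ θ≈θ′ → θ≈θ′ x
  }

postcompose : (𝓕 : BishopSpace c e p) (𝓖 : BishopSpace c′ e′ p′) (𝓗 : BishopSpace c″ e″ p″) →
              Morphism 𝓖 𝓗 → Func (Mor 𝓕 𝓖) (Mor 𝓕 𝓗)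
postcompose 𝓕 𝓖 𝓗 h = record
  { to   = λ θ → record
    { fun        = Morphism.fun h ∘ᶠ Morphism.fun θ
    ; isMorphism = λ g g∈ →
        Morphism.isMorphism θ (g ∘ᶠ Morphism.fun h) (Morphism.isMorphism h g g∈)
    }
  ; cong = λ θ≈θ′ x → Func.cong (Morphism.fun h) (θ≈θ′ x)
  }

-- Evaluating g at x after postcomposing with `h` is evaluating g ∘ `h` at x, so generators pull
-- back to generators.
postcompose-morphism : (𝓕 : BishopSpace c e p) (𝓖 : BishopSpace c′ e′ p′)
                       (𝓗 : BishopSpace c″ e″ p″) (h : Morphism 𝓖 𝓗) →
                       IsMorphism (𝓕 ⇒ 𝓖) (𝓕 ⇒ 𝓗) (postcompose 𝓕 𝓖 𝓗 h)
postcompose-morphism 𝓕 𝓖 𝓗 h =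
  ⋁-lift (BishopSpace.topology (𝓕 ⇒ 𝓖)) (postcompose 𝓕 𝓖 𝓗 h)
    λ k (x , g , g∈ , k≈) →
      base (x , g ∘ᶠ Morphism.fun h , Morphism.isMorphism h g g∈ ,
            λ θ → k≈ (postcompose 𝓕 𝓖 𝓗 h ⟨$⟩ θ))

module _ {I : DirectedSet a ℓ r} (S : ContravariantSpectrum I c e p) where
  open ContravariantSpectrum S

  projection : ∀ i → Morphism (InverseLimit S) (space i)
  projection i = record
    { fun        = π S i
    ; isMorphism = λ h h∈ → base (i , h , h∈ , λ _ → Setoid.refl ℝ-setoid)
    }

module _ {I : DirectedSet a ℓ r} (S : ContravariantSpectrum I c e p)
         (𝓕 : BishopSpace c′ e′ p′) where
  open ContravariantSpectrum S
  private
    module F = BishopSpace 𝓕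
    Lim = InverseLimit S
    Lim⇒ = InverseLimit (𝓕 ⇒ˢ S)

  tuple : Thread (𝓕 ⇒ˢ S) → Morphism 𝓕 Lim
  tuple Φ = record
    { fun        = fun
    ; isMorphism = ⋁-lift F.topology fun λ k (i , h , h∈ , k≈) →
        -- Following `fun` by the i-th projection gives back Φᵢ, itself a morphism.
        F.resp (h ∘ᶠ Morphism.fun (Φ.at i)) (k ∘ᶠ fun)
          (λ x → Setoid.sym ℝ-setoid (k≈ (fun ⟨$⟩ x)))
          (Morphism.isMorphism (Φ.at i) h h∈)
    }
    where
    module Φ = Thread Φ
    fun : Func F.set (ThreadSetoid S)
    fun = record
      { to   = λ x → record
        { at         = λ i → Morphism.fun (Φ.at i) ⟨$⟩ x
        ; compatible = λ i≼j → Φ.compatible i≼j x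
        }
      ; cong = λ x≈y i → Func.cong (Morphism.fun (Φ.at i)) x≈y
      }

  tupleᶠ : Func (ThreadSetoid (𝓕 ⇒ˢ S)) (Mor 𝓕 Lim)
  tupleᶠ = record { to = tuple ; cong = λ Φ≈Ψ x i → Φ≈Ψ i x }

  -- For fixed `x` this map is Φ ↦ (i ↦ Φᵢ x). A generator h ∘ πᵢ pulls back to evaluation of h at
  -- `x` after the i-th projection, a generator of `Lim⇒`.
  evaluateAt∘tuple-morphism : ∀ x → IsMorphism Lim⇒ Lim (evaluateAt 𝓕 Lim x ∘ᶠ tupleᶠ)
  evaluateAt∘tuple-morphism x =
    ⋁-lift (BishopSpace.topology Lim⇒) (evaluateAt 𝓕 Lim x ∘ᶠ tupleᶠ)
      λ k (i , h , h∈ , k≈) →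
        base (i , evalᶠ 𝓕 (space i) x h ,
              base (x , h , h∈ , λ _ → Setoid.refl ℝ-setoid) ,
              λ Φ → k≈ (Morphism.fun (tuple Φ) ⟨$⟩ x))

  tuple-morphism : IsMorphism Lim⇒ (𝓕 ⇒ Lim) tupleᶠ
  tuple-morphism =
    ⋁-lift (BishopSpace.topology Lim⇒) tupleᶠ λ k (x , g , g∈ , k≈) →
      -- Here g is any member of the generated topology on `Lim`, not just a generator, so the lemma
      -- for fixed x is applied to it.
      BishopSpace.resp Lim⇒ (g ∘ᶠ (evaluateAt 𝓕 Lim x ∘ᶠ tupleᶠ)) (k ∘ᶠ tupleᶠ)
        (λ Φ → Setoid.sym ℝ-setoid (k≈ (tuple Φ)))
        (evaluateAt∘tuple-morphism x g g∈)

  components : Morphism 𝓕 Lim → Thread (𝓕 ⇒ˢ S)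
  components θ = record
    -- Written as a postcomposition so that `postcompose-morphism` covers every h in the topology of
    -- 𝓕 → 𝓕ᵢ below.
    { at         = λ i → postcompose 𝓕 Lim (space i) (projection S i) ⟨$⟩ θ
    ; compatible = λ i≼j x → Thread.compatible (Morphism.fun θ ⟨$⟩ x) i≼j
    }

  componentsᶠ : Func (Mor 𝓕 Lim) (ThreadSetoid (𝓕 ⇒ˢ S))
  componentsᶠ = record { to = components ; cong = λ θ≈θ′ i x → θ≈θ′ x i }

  components-morphism : IsMorphism (𝓕 ⇒ Lim) Lim⇒ componentsᶠ
  components-morphism =
    ⋁-lift (BishopSpace.topology (𝓕 ⇒ Lim)) componentsᶠ λ k (i , h , h∈ , k≈) →
      BishopSpace.resp (𝓕 ⇒ Lim)
        (h ∘ᶠ postcompose 𝓕 Lim (space i) (projection S i)) (k ∘ᶠ componentsᶠ)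
        (λ θ → Setoid.sym ℝ-setoid (k≈ (components θ)))
        (postcompose-morphism 𝓕 Lim (space i) (projection S i) h h∈)

theorem11p5 : ∀ {a ℓ r c e p c′ e′ p′ : Level} (I : DirectedSet a ℓ r) (S : ContravariantSpectrum I c e p) (𝓕 : BishopSpace c′ e′ p′) →
    InverseLimit (𝓕 ⇒ˢ S) ≃ (𝓕 ⇒ InverseLimit S)
theorem11p5 I S 𝓕 = record
  { to      = record { fun = tupleᶠ S 𝓕 ; isMorphism = tuple-morphism S 𝓕 }
  ; from    = record { fun = componentsᶠ S 𝓕 ; isMorphism = components-morphism S 𝓕 }
  -- Both maps keep the values Φᵢ x, so each half only exchanges the order of x and i.
  ; inverse = (λ Φ≈ x i → Φ≈ i x) , (λ θ≈ i x → θ≈ x i)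
  }
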